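{- Let $G$ be a countable group acting on $\mathcal W$ (by negligibility-preserving self-homeomorphisms) cocompactly and $\lambda$-properly discontinuously, with a relatively compact fundamental domain, and let $\mathcal T$ be a finite set of relatively compact tiles of $\mathcal W$. Then there exists a finite set $\mathcal K$ of relatively compact tiles yielding a grid on $\mathcal W$ such that every tile in $\mathcal T$ is a poly-$\mathcal K$, and $\mathcal T$ and $\Psi_{\mathcal K}(\mathcal T)=\{\Psi_{\mathcal K}(T) : T\in\mathcal T\}$ have the same cotilers up to renaming each $T$ into $\Psi_{\mathcal K}(T)$; that is, a countable $C\subset G\times\mathcal T$ is a cotiler for $\mathcal T$ in $\mathcal W$ if and only if $G\times\mathcal K=\bigsqcup_{(g,T)\in C}g\cdot\Psi_{\mathcal K}(T)$ (disjoint union, indexed by $C$).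
   Context: $\mathcal W$ is a topological space with a nontrivial Borel measure $\lambda$. The group $G$ acts on $\mathcal W$ by self-homeomorphisms that are negligibility-preserving: $\lambda(A)>0\implies\lambda(g\cdot A)>0$ for all $g\in G$. The relation $\equiv_\lambda$ is equality up to $\lambda$-negligible sets, and $\bigsqcup$ in $\mathcal W$ denotes a union that is disjoint up to $\lambda$-negligible sets. A tile is a positive-measure subset. A set is relatively compact if it is included in a compact set. A cotiler for a set $\mathcal T$ of tiles is a countable $C\subset G\times\mathcal T$ with $\bigsqcup_{(g,T)\in C}g\cdot T\equiv_\lambda\mathcal W$. The action is $\lambda$-properly discontinuous if for every compact $K\subset\mathcal W$, $\lambda(g\cdot K\cap K)>0$ for only finitely many $g\in G$ (equivalently, for all relatively compact $K,K'$, only finitely many $g\cdot K$ intersect $K'$ with positive measure). A fundamental domain is (up to $\lambda$-negligible sets) a measurable set $F$ with $\mathcal W\equiv_\lambda\bigsqcup_{g\in G}g\cdot F$. A finite set $\mathcal K$ of tiles yields a grid if $\mathcal W\equiv_\lambda\bigsqcup_{(h,K)\in G\times\mathcal K}h\cdot K$. Given such $\mathcal K$, a tile $T$ is a poly-$\mathcal K$ if there is a (then unique) finite set $\Psi_{\mathcal K}(T)\subset G\times\mathcal K$ with $T\equiv_\lambda\bigsqcup_{(h,K)\in\Psi_{\mathcal K}(T)}h\cdot K$. The group $G$ acts on $G\times\mathcal K$ by $g\cdot(h,K)=(gh,K)$. -}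

module Defs where

open import Algebra.Bundles using (Group)
open import Data.Fin.Base using (Fin)
open import Data.List.Base using (List)
open import Data.List.Relation.Unary.Any using (Any)
import Data.List.Membership.Setoid as SetoidMembership
open import Data.Nat.Base using (ℕ; zero; suc)
open import Data.Product.Base using (_×_; _,_; proj₁; proj₂; ∃; ∃-syntax; Σ; Σ-syntax)
open import Data.Product.Relation.Binary.Pointwise.NonDependent using (_×ₛ_)
open import Data.Rational.Base as ℚ using (ℚ; 0ℚ; ½)
import Data.Rational.Properties as ℚ
open import Data.Unit.Polymorphic.Base using (tt)
open import Function.Bundles using (Injection)
open import Level using (Level; _⊔_; 0ℓ) renaming (suc to lsuc)
open import Relation.Binary.Bundles using (Setoid)
open import Relation.Binary.Core using (Rel)
import Relation.Binary.Construct.On as On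
open import Relation.Binary.Definitions using (_Respects_)
open import Relation.Binary.PropositionalEquality as ≡ using (_≡_)
open import Relation.Nullary.Negation.Core using (¬_)
open import Relation.Unary using (Pred; _⊆_; _≐_; _∩_; _∪_; _∖_; ∁; ⋃; _⊥_)
open import Relation.Unary.Polymorphic using (U; ∅)

private
  variable
    a b i p q r ℓ : Level

------------------------------------------------------------------------
-- Subsets of setoids

record Subset (S : Setoid a ℓ) (p : Level) : Set (a ⊔ ℓ ⊔ lsuc p) where
  open Setoid S using (Carrier; _≈_)
  field
    member   : Pred Carrier p
    respects : member Respects _≈_

open Subset public

subsetoid : (S : Setoid a ℓ) → Subset S p → Setoid (a ⊔ p) ℓ
subsetoid S P = On.setoid {B = Σ (Setoid.Carrier S) (member P)} S proj₁

Countable : Setoid a ℓ → Set (a ⊔ ℓ)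
Countable S = Injection S (≡.setoid ℕ)

-- Contained in the set of entries of a list; classically this is finiteness.
Finite : (S : Setoid a ℓ) → Pred (Setoid.Carrier S) p → Set (a ⊔ ℓ ⊔ p)
Finite S P = ∃[ xs ] (∀ {x} → P x → x ∈ xs)
  where open SetoidMembership S using (_∈_)

Image : {A : Set a} (S : Setoid b ℓ) → (A → Setoid.Carrier S) →
        Pred A p → Pred (Setoid.Carrier S) (a ⊔ ℓ ⊔ p)
Image S f P y = ∃[ x ] (P x × f x ≈ y)
  where open Setoid S using (_≈_)

-- P is the disjoint union of the subsets A i.  Distinct indices must have
-- disjoint pieces, even when the pieces coincide as sets.
record _≐⨆[_]_ {X : Set a} (P : Pred X p) (I : Setoid i ℓ)
               (A : Setoid.Carrier I → Pred X q) : Set (a ⊔ p ⊔ i ⊔ ℓ ⊔ q) where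
  open Setoid I renaming (Carrier to Index)
  field
    disjoint : ∀ {j k} → ¬ j ≈ k → A j ⊥ A k
    union    : P ≐ ⋃ Index A

------------------------------------------------------------------------
-- Extended nonnegative reals

-- x ∈ [0,∞] is given by its lower cut {q ∈ ℚ ∣ q < x}; ∞ is the cut ℚ.
record [0,∞] : Set₁ where
  field
    below    : Pred ℚ 0ℓ
    negative : ∀ {q} → q ℚ.< 0ℚ → below q
    down     : ∀ {q r} → q ℚ.≤ r → below r → below q
    rounded  : ∀ {q} → below q → ∃[ r ] (q ℚ.< r × below r)

open [0,∞] public

infix 4 _≃_
_≃_ : Rel [0,∞] 0ℓ
x ≃ y = below x ≐ below y

Positive : Pred [0,∞] 0ℓ
Positive x = below x 0ℚ

0∞ : [0,∞]
0∞ = record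
  { below    = ℚ._< 0ℚ
  ; negative = λ q<0 → q<0
  ; down     = ℚ.≤-<-trans
  ; rounded  = ℚ.<-dense
  }

infixl 6 _+∞_
_+∞_ : [0,∞] → [0,∞] → [0,∞]
x +∞ y = record
  { below    = λ q → ∃[ r ] ∃[ s ] (below x r × below y s × q ℚ.≤ r ℚ.+ s)
  ; negative = λ {q} q<0 →
      let ½q<0 = ≡.subst (½ ℚ.* q ℚ.<_) (ℚ.*-zeroʳ ½) (ℚ.*-monoʳ-<-pos ½ q<0)
          q≡½q+½q = ≡.trans (≡.sym (ℚ.*-identityˡ q)) (ℚ.*-distribʳ-+ q ½ ½)
      in ½ ℚ.* q , ½ ℚ.* q , negative x ½q<0 , negative y ½q<0 , ℚ.≤-reflexive q≡½q+½q
  ; down     = λ { q≤q′ (r , s , xr , ys , q′≤) → r , s , xr , ys , ℚ.≤-trans q≤q′ q′≤ }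
  ; rounded  = λ { (r , s , xr , ys , q≤) →
      let (r′ , r<r′ , xr′) = rounded x xr
      in r′ ℚ.+ s , ℚ.≤-<-trans q≤ (ℚ.+-monoˡ-< s r<r′) ,
         r′ , s , xr′ , ys , ℚ.≤-refl }
  }

partialSum : (ℕ → [0,∞]) → ℕ → [0,∞]
partialSum x zero    = 0∞
partialSum x (suc n) = partialSum x n +∞ x n

-- The supremum of the partial sums.
∑∞ : (ℕ → [0,∞]) → [0,∞]
∑∞ x = record
  { below    = λ q → ∃[ n ] below (partialSum x n) q
  ; negative = λ q<0 → zero , q<0
  ; down     = λ { q≤r (n , r<) → n , down (partialSum x n) q≤r r< }
  ; rounded  = λ { (n , q<) →
      let (r , q<r , r<) = rounded (partialSum x n) q< in r , q<r , n , r< }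
  }

------------------------------------------------------------------------
-- Topological spaces and compactness

-- Points are compared by a setoid equality, which makes quotient spaces
-- available.
record TopologicalSpace (ℓ : Level) : Set (lsuc (lsuc ℓ)) where
  field
    setoid : Setoid ℓ ℓ
  open Setoid setoid public
  field
    IsOpen      : Pred (Pred Carrier ℓ) (lsuc ℓ)
    open-resp-≈ : ∀ {V} → IsOpen V → V Respects _≈_
    open-resp-≐ : ∀ {V W} → V ≐ W → IsOpen V → IsOpen W
    open-U      : IsOpen U
    open-∩      : ∀ {V W} → IsOpen V → IsOpen W → IsOpen (V ∩ W)
    open-⋃      : {I : Set ℓ} (V : I → Pred Carrier ℓ) →
                  (∀ i → IsOpen (V i)) → IsOpen (⋃ I V)

module _ (𝒲 : TopologicalSpace ℓ) where
  open TopologicalSpace 𝒲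

  Compact : Pred (Pred Carrier ℓ) (lsuc ℓ)
  Compact K = {I : Set ℓ} (V : I → Pred Carrier ℓ) → (∀ i → IsOpen (V i)) →
              K ⊆ ⋃ I V →
              Σ[ is ∈ List I ] (∀ {x} → K x → Any (λ i → V i x) is)

  RelativelyCompact : Pred (Pred Carrier ℓ) (lsuc ℓ)
  RelativelyCompact A = ∃[ K ] (Compact K × A ⊆ K)

  data Borel : Pred (Pred Carrier ℓ) (lsuc ℓ) where
    isOpen      : ∀ {A} → IsOpen A → Borel A
    complement  : ∀ {A} → Borel A → Borel (∁ A)
    countable-⋃ : (A : ℕ → Pred Carrier ℓ) → (∀ n → Borel (A n)) → Borel (⋃ ℕ A)
    resp-≐      : ∀ {A B} → A ≐ B → Borel A → Borel B

------------------------------------------------------------------------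
-- Borel measures

record BorelMeasure (𝒲 : TopologicalSpace ℓ) : Set (lsuc ℓ) where
  open TopologicalSpace 𝒲 using (Carrier)
  field
    measure    : ∀ {A} → Borel 𝒲 A → [0,∞]
    well-def   : ∀ {A B} (bA : Borel 𝒲 A) (bB : Borel 𝒲 B) →
                 A ≐ B → measure bA ≃ measure bB
    measure-∅  : (b∅ : Borel 𝒲 ∅) → measure b∅ ≃ 0∞
    σ-additive : (A : ℕ → Pred Carrier ℓ) (bA : ∀ n → Borel 𝒲 (A n)) →
                 (∀ {m n} → ¬ m ≡ n → A m ⊥ A n) →
                 measure (countable-⋃ A bA) ≃ ∑∞ (λ n → measure (bA n))

module _ {𝒲 : TopologicalSpace ℓ} (μ : BorelMeasure 𝒲) where
  open TopologicalSpace 𝒲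
  open BorelMeasure μ

  Nontrivial : Set
  Nontrivial = Positive (measure (isOpen open-U))

  Negligible : Pred (Pred Carrier ℓ) (lsuc ℓ)
  Negligible A = ∃[ B ] Σ[ bB ∈ Borel 𝒲 B ] (A ⊆ B × measure bB ≃ 0∞)

  -- For Borel A this amounts to μ(A) > 0.  For other A, such as compact sets
  -- of a non-Hausdorff space, it says that the outer measure is positive.
  PositiveMeasure : Pred (Pred Carrier ℓ) (lsuc ℓ)
  PositiveMeasure A = ∀ {B} (bB : Borel 𝒲 B) → A ⊆ B → Positive (measure bB)

  infix 4 _≡μ_
  _≡μ_ : Rel (Pred Carrier ℓ) (lsuc ℓ)
  A ≡μ B = Negligible ((A ∖ B) ∪ (B ∖ A))

  record _≡μ⨆[_]_ (P : Pred Carrier ℓ) (I : Setoid ℓ ℓ)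
                  (A : Setoid.Carrier I → Pred Carrier ℓ) : Set (lsuc ℓ) where
    open Setoid I using () renaming (Carrier to Index; _≈_ to _≈ᵢ_)
    field
      disjoint : ∀ {j k} → ¬ j ≈ᵢ k → Negligible (A j ∩ A k)
      union    : P ≡μ ⋃ Index A

  IsTile : Pred (Pred Carrier ℓ) (lsuc ℓ)
  IsTile T = Borel 𝒲 T × PositiveMeasure T

  record FiniteTileSet : Set (lsuc ℓ) where
    field
      size     : ℕ
      tile     : Fin size → Pred Carrier ℓ
      isTile   : ∀ i → IsTile (tile i)
      distinct : ∀ {i j} → tile i ≐ tile j → i ≡ j

open FiniteTileSet public

------------------------------------------------------------------------
-- Group actions

-- Each g •_ is a homeomorphism, with continuous inverse g ⁻¹ •_.
record Action (G : Group ℓ ℓ) (𝒲 : TopologicalSpace ℓ) : Set (lsuc ℓ) where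
  private module G = Group G
  open TopologicalSpace 𝒲
  infixr 7 _•_
  field
    _•_        : G.Carrier → Carrier → Carrier
    •-cong     : ∀ {g h x y} → g G.≈ h → x ≈ y → g • x ≈ h • y
    identity   : ∀ x → G.ε • x ≈ x
    compatible : ∀ g h x → (g G.∙ h) • x ≈ g • h • x
    continuous : ∀ g {V} → IsOpen V → IsOpen (λ x → V (g • x))

  _·_ : G.Carrier → Pred Carrier ℓ → Pred Carrier ℓ
  g · A = Image setoid (g •_) A

module _ {G : Group ℓ ℓ} {𝒲 : TopologicalSpace ℓ} (act : Action G 𝒲) where
  private module G = Group G
  open TopologicalSpace 𝒲
  open Action act

  orbitSetoid : Setoid ℓ ℓ
  orbitSetoid = record
    { Carrier = Carrier
    ; _≈_     = λ x y → ∃[ g ] g • x ≈ y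
    ; isEquivalence = record
      { refl  = G.ε , identity _
      ; sym   = λ { {x} (g , gx≈y) → g G.⁻¹ ,
          trans (•-cong G.refl (sym gx≈y))
            (trans (sym (compatible (g G.⁻¹) g x))
              (trans (•-cong (G.inverseˡ g) refl) (identity x))) }
      ; trans = λ { {x} (g , gx≈y) (h , hy≈z) → h G.∙ g ,
          trans (compatible h g x) (trans (•-cong G.refl gx≈y) hy≈z) }
      }
    }

  -- The quotient topology on 𝒲/G: a subset of 𝒲/G is a G-invariant
  -- predicate on 𝒲, and this predicate is also its preimage in 𝒲.
  orbitSpace : TopologicalSpace ℓ
  orbitSpace = record
    { setoid      = orbitSetoid
    ; IsOpen      = λ V → IsOpen V × V Respects _~_
    ; open-resp-≈ = proj₂
    ; open-resp-≐ = λ { V≐W (oV , rV) → open-resp-≐ V≐W oV ,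
                        λ x~y Wx → proj₁ V≐W (rV x~y (proj₂ V≐W Wx)) }
    ; open-U      = open-U , λ _ _ → tt
    ; open-∩      = λ { (oV , rV) (oW , rW) → open-∩ oV oW ,
                        λ { x~y (Vx , Wx) → rV x~y Vx , rW x~y Wx } }
    ; open-⋃      = λ V oV → open-⋃ V (λ i → proj₁ (oV i)) ,
                        λ { x~y (i , Vx) → i , proj₂ (oV i) x~y Vx }
    }
    where open Setoid orbitSetoid using () renaming (_≈_ to _~_)

  Cocompact : Set (lsuc ℓ)
  Cocompact = Compact orbitSpace U

module _ {G : Group ℓ ℓ} {𝒲 : TopologicalSpace ℓ}
         (μ : BorelMeasure 𝒲) (act : Action G 𝒲) where
  private module G = Group G
  open TopologicalSpace 𝒲
  open Action act

  NegligibilityPreserving : Set (lsuc ℓ)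
  NegligibilityPreserving =
    ∀ g {A} → Borel 𝒲 A → PositiveMeasure μ A → PositiveMeasure μ (g · A)

  ProperlyDiscontinuous : Set (lsuc ℓ)
  ProperlyDiscontinuous =
    ∀ {K} → Compact 𝒲 K → Finite G.setoid (λ g → PositiveMeasure μ ((g · K) ∩ K))

  IsFundamentalDomain : Pred (Pred Carrier ℓ) (lsuc ℓ)
  IsFundamentalDomain F = Borel 𝒲 F × _≡μ⨆[_]_ μ U G.setoid (λ g → g · F)

  -- The set G × 𝒯.
  Placements : FiniteTileSet μ → Setoid ℓ ℓ
  Placements 𝒯 = G.setoid ×ₛ ≡.setoid (Fin (size 𝒯))

  placed : (𝒯 : FiniteTileSet μ) → Setoid.Carrier (Placements 𝒯) → Pred Carrier ℓ
  placed 𝒯 (g , i) = g · tile 𝒯 i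

  YieldsGrid : FiniteTileSet μ → Set (lsuc ℓ)
  YieldsGrid 𝒦 = _≡μ⨆[_]_ μ U (Placements 𝒦) (placed 𝒦)

  IsCotiler : (𝒯 : FiniteTileSet μ) → Subset (Placements 𝒯) ℓ → Set (lsuc ℓ)
  IsCotiler 𝒯 C = Countable C′ × _≡μ⨆[_]_ μ U C′ (λ c → placed 𝒯 (proj₁ c))
    where C′ = subsetoid (Placements 𝒯) C

  record IsPoly (𝒦 : FiniteTileSet μ) (T : Pred Carrier ℓ) : Set (lsuc ℓ) where
    field
      Ψ         : Subset (Placements 𝒦) ℓ
      finite    : Finite (Placements 𝒦) (member Ψ)
      decompose : _≡μ⨆[_]_ μ T (subsetoid (Placements 𝒦) Ψ) (λ c → placed 𝒦 (proj₁ c))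

  translate : (𝒦 : FiniteTileSet μ) → G.Carrier →
              Pred (Setoid.Carrier (Placements 𝒦)) ℓ → Pred (Setoid.Carrier (Placements 𝒦)) ℓ
  translate 𝒦 g = Image (Placements 𝒦) (λ (h , k) → g G.∙ h , k)

  -- G × 𝒦 is the disjoint union of the g·Ψ(T), indexed by (g , T) ∈ C.
  IsExactCotiler : (𝒯 𝒦 : FiniteTileSet μ) → (∀ i → IsPoly 𝒦 (tile 𝒯 i)) →
                   Subset (Placements 𝒯) ℓ → Set ℓ
  IsExactCotiler 𝒯 𝒦 poly C =
    U {ℓ = ℓ} ≐⨆[ subsetoid (Placements 𝒯) C ]
      λ { ((g , i) , _) → translate 𝒦 g (member (IsPoly.Ψ (poly i))) }

{-# OPTIONS --safe #-}
module Submission where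

-- Cut the relatively compact fundamental domain F along the finitely many translates of tiles of 𝒯
-- that meet it in positive measure, and let 𝒦 consist of the nonnegligible atoms.  Then G × 𝒦 is a
-- grid, and every h·K is either contained in a given T ∈ 𝒯 or almost disjoint from it, so that T is
-- almost the union of the pieces h·K ⊆ T, finitely many by proper discontinuity.  A union of grid
-- pieces determines its index set, since each piece is nonnegligible while it is almost disjoint
-- from any countable union of the others; this turns coverings and disjointness modulo negligible
-- sets into exact statements about index sets.

open import Defs
open import Algebra.Bundles using (Group)
open import Axiom.ExcludedMiddle using (ExcludedMiddle)
open import Data.Empty using (⊥-elim)
open import Data.Fin.Base using (Fin; zero; suc)
import Data.Fin.Properties as Fin
open import Data.List.Base using (List; []; _∷_; _++_; length; lookup; allFin; cartesianProduct)
open import Data.List.Membership.Propositional.Properties using (∈-lookup; ∈-allFin)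
import Data.List.Membership.Setoid as SetoidMembership
open import Data.List.Membership.Setoid.Properties using (∈-cartesianProduct⁺)
open import Data.List.Relation.Unary.All as All using (All; []; _∷_)
import Data.List.Relation.Unary.All.Properties as All
open import Data.List.Relation.Unary.AllPairs using (AllPairs; []; _∷_)
import Data.List.Relation.Unary.AllPairs.Properties as AllPairs
open import Data.List.Relation.Unary.Any using (Any; here; index)
import Data.List.Relation.Unary.Any.Properties as Any
open import Data.Nat.Base using (ℕ; zero; suc; _<′_; <′-base; ≤′-step)
import Data.Nat.Properties as ℕ
open import Data.Product.Base using (_×_; _,_; proj₁; proj₂; ∃-syntax)
open import Data.Product.Relation.Binary.Pointwise.NonDependent using (_×ₛ_)
open import Data.Rational.Base as ℚ using (0ℚ)
import Data.Rational.Properties as ℚ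
open import Data.Sum.Base using (_⊎_; inj₁; inj₂; [_,_]′)
open import Function.Base using (_∘_; id)
open import Function.Bundles using (_⇔_; mk⇔; Injection)
open import Level using (Level; Lift; lift; lower) renaming (suc to lsuc)
open import Relation.Binary.Bundles using (Setoid)
open import Relation.Binary.Core using (Rel)
open import Relation.Binary.Definitions using (_Respects_; Symmetric; tri<; tri≈; tri>)
open import Relation.Binary.PropositionalEquality as ≡ using (_≡_; refl)
open import Relation.Nullary using (¬_; yes; no; contradiction)
open import Relation.Nullary.Decidable using (map′; decidable-stable)
open import Relation.Unary using (Pred; _⊆_; _≐_; _∩_; _∪_; _∖_; ⋃; _⊥_)
open import Relation.Unary.Polymorphic using (U; ∅)

-- Positivity and vanishing of extended nonnegative reals

¬positive⇒≃0 : ∀ x → ¬ Positive x → x ≃ 0∞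
¬positive⇒≃0 x ¬x>0 =
  (λ xq → ℚ.≰⇒> λ 0≤q → ¬x>0 (down x 0≤q xq)) , negative x

≃0⇒¬positive : ∀ x → x ≃ 0∞ → ¬ Positive x
≃0⇒¬positive x x≃0 x>0 = ℚ.<-irrefl refl (proj₁ x≃0 x>0)

positive-∑∞ : ∀ x → Positive (x 0) → Positive (∑∞ x)
positive-∑∞ x x₀>0 with rounded (x 0) x₀>0
... | s , 0<s , x₀>s =
  -- The first partial sum is `0∞ +∞ x 0`, and the cut of `0∞` offers only strictly negative
  -- rationals; rounding 0 up to `s` leaves room for the summand `- s`.
  1 , ℚ.- s , s , ℚ.neg-antimono-< 0<s , x₀>s , ℚ.≤-reflexive (≡.sym (ℚ.+-inverseˡ s))

¬positive-∑∞ : ∀ x → (∀ n → x n ≃ 0∞) → ¬ Positive (∑∞ x)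
¬positive-∑∞ x x≃0 (n , S>0) = ℚ.<-irrefl refl (partial n S>0)
  where
  -- Stated for every rational of the cut rather than for 0, since an element of a sum splits into
  -- arbitrary summands.
  partial : ∀ n {q} → below (partialSum x n) q → q ℚ.< 0ℚ
  partial zero    q<0                  = q<0
  partial (suc n) (r , s , r< , s< , q≤) =
    ℚ.≤-<-trans q≤ (ℚ.+-mono-< (partial n r<) (proj₁ (x≃0 n) s<))

-- Two-set unions as sequences, and pairwise relations on lists

pair : ∀ {ℓ} {X : Set ℓ} (A B : Pred X ℓ) → ℕ → Pred X ℓ
pair A B zero    = A
pair A B (suc _) = B

⋃-pair : ∀ {ℓ} {X : Set ℓ} {A B : Pred X ℓ} → ⋃ ℕ (pair A B) ≐ A ∪ B
⋃-pair = (λ { (zero , Ax) → inj₁ Ax ; (suc _ , Bx) → inj₂ Bx }) ,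
         [ (λ Ax → 0 , Ax) , (λ Bx → 1 , Bx) ]′

lookup-AllPairs : ∀ {a r} {A : Set a} {R : Rel A r} → Symmetric R → ∀ {xs} → AllPairs R xs →
                  ∀ i j → ¬ i ≡ j → R (lookup xs i) (lookup xs j)
lookup-AllPairs R-sym (x~xs ∷ _)  zero    zero    0≢0 = contradiction refl 0≢0
lookup-AllPairs R-sym (x~xs ∷ _)  zero    (suc j) _   = All.lookup x~xs (∈-lookup j)
lookup-AllPairs R-sym (x~xs ∷ _)  (suc i) zero    _   = R-sym (All.lookup x~xs (∈-lookup i))
lookup-AllPairs R-sym (_ ∷ pairs) (suc i) (suc j) i≢j =
  lookup-AllPairs R-sym pairs i j (i≢j ∘ ≡.cong suc)

module Classical {ℓ : Level} (em : ExcludedMiddle (lsuc ℓ)) where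

  em↓ : ExcludedMiddle ℓ
  em↓ {P} = map′ lower lift (em {Lift (lsuc ℓ) P})

  -- Borel sets under the classical set operations

  module _ {𝒲 : TopologicalSpace ℓ} where
    open TopologicalSpace 𝒲 using (Carrier; _≈_; IsOpen; open-U; open-resp-≈; sym)

    -- Images under the action are taken up to `≈`, so comparing them with preimages requires the
    -- set itself to be closed under `≈`. Open sets are so by assumption, and each Borel operation
    -- keeps this.
    Borel-respects : ∀ {A} → Borel 𝒲 A → A Respects _≈_
    Borel-respects (isOpen oA)         x≈y Ax       = open-resp-≈ oA x≈y Ax
    Borel-respects (complement bA)     x≈y ¬Ax Ay   = ¬Ax (Borel-respects bA (sym x≈y) Ay)
    Borel-respects (countable-⋃ A bA)  x≈y (n , Ax) = n , Borel-respects (bA n) x≈y Ax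
    Borel-respects (resp-≐ A≐B bA)     x≈y Bx       =
      proj₁ A≐B (Borel-respects bA x≈y (proj₂ A≐B Bx))

    Borel-∅ : Borel 𝒲 ∅
    Borel-∅ = resp-≐ ((λ ¬U → ⊥-elim (¬U _)) , λ ()) (complement (isOpen open-U))

    Borel-∪ : ∀ {A B} → Borel 𝒲 A → Borel 𝒲 B → Borel 𝒲 (A ∪ B)
    Borel-∪ {A} {B} bA bB =
      resp-≐ ⋃-pair (countable-⋃ (pair A B) λ { zero → bA ; (suc _) → bB })

    Borel-∖ : ∀ {A B} → Borel 𝒲 A → Borel 𝒲 B → Borel 𝒲 (A ∖ B)
    Borel-∖ bA bB = resp-≐
      ( (λ ¬∁A∪B → decidable-stable em↓ (¬∁A∪B ∘ inj₁) , ¬∁A∪B ∘ inj₂)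
      , λ (Ax , ¬Bx) → [ (λ ¬Ax → ¬Ax Ax) , ¬Bx ]′ )
      (complement (Borel-∪ (complement bA) bB))

    Borel-∩ : ∀ {A B} → Borel 𝒲 A → Borel 𝒲 B → Borel 𝒲 (A ∩ B)
    Borel-∩ bA bB = resp-≐
      ((λ (Ax , ¬¬Bx) → Ax , decidable-stable em↓ ¬¬Bx) , λ (Ax , Bx) → Ax , λ ¬Bx → ¬Bx Bx)
      (Borel-∖ bA (complement bB))

  -- Making a sequence of sets disjoint

  module Disjointify {X : Set ℓ} (A : ℕ → Pred X ℓ) where

    before : ℕ → Pred X ℓ
    before zero    = ∅
    before (suc n) = before n ∪ A n

    new : ℕ → Pred X ℓ
    new n = A n ∖ before n

    before-mono : ∀ {m n} → m <′ n → A m ⊆ before n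
    before-mono <′-base       = inj₂
    before-mono (≤′-step m<n) = inj₁ ∘ before-mono m<n

    new-disjoint : ∀ {m n} → ¬ m ≡ n → new m ⊥ new n
    new-disjoint {m} {n} m≢n ((Am , ¬Bm) , (An , ¬Bn)) with ℕ.<-cmp m n
    ... | tri< m<n _ _ = ¬Bn (before-mono (ℕ.<⇒<′ m<n) Am)
    ... | tri≈ _ m≡n _ = m≢n m≡n
    ... | tri> _ _ n<m = ¬Bm (before-mono (ℕ.<⇒<′ n<m) An)

    -- The recursion descends to the first index whose set contains the point, deciding at each
    -- stage whether an earlier one does.
    before⊆⋃new : ∀ n → before n ⊆ ⋃ ℕ new
    before⊆⋃new (suc n) (inj₁ Bx) = before⊆⋃new n Bx
    before⊆⋃new (suc n) {x} (inj₂ Ax) with em↓ {before n x}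
    ... | yes Bx = before⊆⋃new n Bx
    ... | no ¬Bx = n , Ax , ¬Bx

    ⋃⊆⋃new : ⋃ ℕ A ⊆ ⋃ ℕ new
    ⋃⊆⋃new (n , Ax) = before⊆⋃new (suc n) (inj₂ Ax)

  -- Negligible sets and their countable unions

  module Null {𝒲 : TopologicalSpace ℓ} (μ : BorelMeasure 𝒲) where
    open TopologicalSpace 𝒲 using (Carrier)
    open BorelMeasure μ

    -- Comes from σ-additivity applied to the sequence consisting of `A`, the rest of `B`, and then
    -- empty sets: its first term is already positive.
    positive-mono : ∀ {A B} (bA : Borel 𝒲 A) (bB : Borel 𝒲 B) → A ⊆ B →
                    Positive (measure bA) → Positive (measure bB)
    positive-mono {A} {B} bA bB A⊆B A>0 =
      proj₂ (well-def bB (countable-⋃ S bS) (B⊆⋃S , ⋃S⊆B))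
        (proj₂ (σ-additive S bS S-disjoint) (positive-∑∞ (λ n → measure (bS n)) A>0))
      where
      S : ℕ → Pred Carrier ℓ
      S 0             = A
      S 1             = B ∖ A
      S (suc (suc _)) = ∅

      bS : ∀ n → Borel 𝒲 (S n)
      bS 0             = bA
      bS 1             = Borel-∖ bB bA
      bS (suc (suc _)) = Borel-∅

      S-disjoint : ∀ {m n} → ¬ m ≡ n → S m ⊥ S n
      S-disjoint {0} {0} 0≢0 _                = 0≢0 refl
      S-disjoint {0} {1} _   (Ax , _ , ¬Ax)   = ¬Ax Ax
      S-disjoint {1} {0} _   ((_ , ¬Ax) , Ax) = ¬Ax Ax
      S-disjoint {1} {1} 1≢1 _                = 1≢1 refl
      S-disjoint {suc (suc _)} _ (() , _)
      S-disjoint {_} {suc (suc _)} _ (_ , ())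

      B⊆⋃S : B ⊆ ⋃ ℕ S
      B⊆⋃S {x} Bx with em↓ {A x}
      ... | yes Ax = 0 , Ax
      ... | no ¬Ax = 1 , Bx , ¬Ax

      ⋃S⊆B : ⋃ ℕ S ⊆ B
      ⋃S⊆B (0 , Ax)     = A⊆B Ax
      ⋃S⊆B (1 , Bx , _) = Bx

    positive⇒¬negligible : ∀ {A} → PositiveMeasure μ A → ¬ Negligible μ A
    positive⇒¬negligible A>0 (_ , bB , A⊆B , B≃0) = ≃0⇒¬positive (measure bB) B≃0 (A>0 bB A⊆B)

    -- A Borel superset without positive measure has measure zero and would itself witness
    -- negligibility; `A` need not be Borel.
    ¬negligible⇒positive : ∀ {A} → ¬ Negligible μ A → PositiveMeasure μ A
    ¬negligible⇒positive ¬null bB A⊆B = decidable-stable (map′ lower lift (em {Lift (lsuc ℓ) _}))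
      λ ¬B>0 → ¬null (_ , bB , A⊆B , ¬positive⇒≃0 (measure bB) ¬B>0)

    negligible-⊆ : ∀ {A B} → A ⊆ B → Negligible μ B → Negligible μ A
    negligible-⊆ A⊆B (C , bC , B⊆C , C≃0) = C , bC , B⊆C ∘ A⊆B , C≃0

    negligible-∅ : Negligible μ ∅
    negligible-∅ = ∅ , Borel-∅ , id , measure-∅ Borel-∅

    -- The Borel null supersets are made disjoint first, because additivity is available only for
    -- disjoint sequences; each new part stays null by monotonicity.
    negligible-⋃ℕ : (A : ℕ → Pred Carrier ℓ) → (∀ n → Negligible μ (A n)) → Negligible μ (⋃ ℕ A)
    negligible-⋃ℕ A null =
      ⋃ ℕ new , countable-⋃ new bnew ,
      (λ (n , Ax) → ⋃⊆⋃new (n , proj₁ (proj₂ (proj₂ (null n))) Ax)) ,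
      ¬positive⇒≃0 (measure (countable-⋃ new bnew)) λ ⋃>0 →
        ¬positive-∑∞ (λ n → measure (bnew n)) new≃0 (proj₁ (σ-additive new bnew new-disjoint) ⋃>0)
      where
      B : ℕ → Pred Carrier ℓ
      B n = proj₁ (null n)

      bB : ∀ n → Borel 𝒲 (B n)
      bB n = proj₁ (proj₂ (null n))

      open Disjointify B

      bbefore : ∀ n → Borel 𝒲 (before n)
      bbefore zero    = Borel-∅
      bbefore (suc n) = Borel-∪ (bbefore n) (bB n)

      bnew : ∀ n → Borel 𝒲 (new n)
      bnew n = Borel-∖ (bB n) (bbefore n)

      new≃0 : ∀ n → measure (bnew n) ≃ 0∞
      new≃0 n = ¬positive⇒≃0 (measure (bnew n)) λ new>0 →
        ≃0⇒¬positive (measure (bB n)) (proj₂ (proj₂ (proj₂ (null n))))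
          (positive-mono (bnew n) (bB n) proj₁ new>0)

    negligible-∪ : ∀ {A B} → Negligible μ A → Negligible μ B → Negligible μ (A ∪ B)
    negligible-∪ {A} {B} nullA nullB = negligible-⊆ (proj₂ ⋃-pair)
      (negligible-⋃ℕ (pair A B) λ { zero → nullA ; (suc _) → nullB })

    -- Used in place of countability, so that G × 𝒦 needs no pairing function.
    NegligibleUnions : Setoid ℓ ℓ → Set (lsuc ℓ)
    NegligibleUnions I = {A : Index → Pred Carrier ℓ} → (∀ {i j} → i ≈ᵢ j → A i ⊆ A j) →
                         (∀ i → Negligible μ (A i)) → Negligible μ (⋃ Index A)
      where open Setoid I using () renaming (Carrier to Index; _≈_ to _≈ᵢ_)

    -- Countability is an injection into ℕ, so the family is regrouped by fibres: injectivity makes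
    -- each fibre either empty or contained in a single member of the family.
    countable⇒negligibleUnions : (I : Setoid ℓ ℓ) → Countable I → NegligibleUnions I
    countable⇒negligibleUnions I count {A} A-resp null =
      negligible-⊆ (λ (i , Ax) → to i , i , refl , Ax) (negligible-⋃ℕ fibre fibre-null)
      where
      open Injection count using (to; injective)

      fibre : ℕ → Pred Carrier ℓ
      fibre n x = ∃[ i ] (to i ≡ n × A i x)

      fibre-null : ∀ n → Negligible μ (fibre n)
      fibre-null n with em↓ {∃[ i ] Lift ℓ (to i ≡ n)}
      ... | yes (i , lift i↦n) = negligible-⊆
        (λ (j , j↦n , Ajx) → A-resp (injective (≡.trans j↦n (≡.sym i↦n))) Ajx) (null i)
      ... | no ¬∃ = negligible-⊆ (λ (j , j↦n , _) → contradiction (j , lift j↦n) ¬∃) negligible-∅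

    negligible-⋃Fin : ∀ n {A : Fin n → Pred Carrier ℓ} →
                      (∀ k → Negligible μ (A k)) → Negligible μ (⋃ (Fin n) A)
    negligible-⋃Fin zero    null = negligible-⊆ (λ { (() , _) }) negligible-∅
    negligible-⋃Fin (suc n) null = negligible-⊆
      (λ { (zero , Ax) → inj₁ Ax ; (suc k , Ax) → inj₂ (k , Ax) })
      (negligible-∪ (null zero) (negligible-⋃Fin n (null ∘ suc)))

    negligibleUnions-×Fin : ∀ (I : Setoid ℓ ℓ) n → NegligibleUnions I →
                            NegligibleUnions (I ×ₛ ≡.setoid (Fin n))
    negligibleUnions-×Fin I n ⋃I A-resp null = negligible-⊆ (λ ((i , k) , Ax) → i , k , Ax)
      (⋃I (λ i≈j (k , Ax) → k , A-resp (i≈j , refl) Ax) λ i → negligible-⋃Fin n λ k → null (i , k))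

    -- Lets a union over a subset of an index setoid be treated as a union over the whole setoid,
    -- with the membership condition moved into the sets.
    negligible-when : ∀ {B} (Q : Set ℓ) → (Q → Negligible μ B) → Negligible μ (λ x → Q × B x)
    negligible-when Q null with em↓ {Q}
    ... | yes q = negligible-⊆ proj₂ (null q)
    ... | no ¬q = negligible-⊆ (λ (q , _) → contradiction q ¬q) negligible-∅

    -- Inclusion up to negligible sets

    infix 4 _≲_
    _≲_ : Pred Carrier ℓ → Pred Carrier ℓ → Set (lsuc ℓ)
    A ≲ B = Negligible μ (A ∖ B)

    ⊆⇒≲ : ∀ {A B} → A ⊆ B → A ≲ B
    ⊆⇒≲ A⊆B = negligible-⊆ (λ (Ax , ¬Bx) → contradiction (A⊆B Ax) ¬Bx) negligible-∅

    ≲-trans : ∀ {A B C} → A ≲ B → B ≲ C → A ≲ C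
    ≲-trans {A} {B} {C} A≲B B≲C = negligible-⊆ split (negligible-∪ A≲B B≲C)
      where
      split : A ∖ C ⊆ (A ∖ B) ∪ (B ∖ C)
      split {x} (Ax , ¬Cx) with em↓ {B x}
      ... | yes Bx = inj₂ (Bx , ¬Cx)
      ... | no ¬Bx = inj₁ (Ax , ¬Bx)

    ≲-∩ : ∀ {A B A′ B′} → A ≲ A′ → B ≲ B′ → A ∩ B ≲ A′ ∩ B′
    ≲-∩ {A} {B} {A′} {B′} A≲A′ B≲B′ = negligible-⊆ split (negligible-∪ A≲A′ B≲B′)
      where
      split : (A ∩ B) ∖ (A′ ∩ B′) ⊆ (A ∖ A′) ∪ (B ∖ B′)
      split {x} ((Ax , Bx) , ¬A′B′) with em↓ {A′ x}
      ... | yes A′x = inj₂ (Bx , λ B′x → ¬A′B′ (A′x , B′x))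
      ... | no ¬A′x = inj₁ (Ax , ¬A′x)

    negligible-≲ : ∀ {A B} → A ≲ B → Negligible μ B → Negligible μ A
    negligible-≲ {A} {B} A≲B nullB = negligible-⊆ split (negligible-∪ A≲B nullB)
      where
      split : A ⊆ (A ∖ B) ∪ B
      split {x} Ax with em↓ {B x}
      ... | yes Bx = inj₂ Bx
      ... | no ¬Bx = inj₁ (Ax , ¬Bx)

    ⋃-≲ : (I : Setoid ℓ ℓ) → NegligibleUnions I → let open Setoid I using () renaming (_≈_ to _≈ᵢ_) in
          ∀ {A B} → (∀ {i j} → i ≈ᵢ j → A i ⊆ A j) →
          (∀ i → A i ≲ B) → ⋃ (Setoid.Carrier I) A ≲ B
    ⋃-≲ I ⋃I A-resp A≲B = negligible-⊆ (λ ((i , Ax) , ¬Bx) → i , Ax , ¬Bx)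
      (⋃I (λ i≈j (Ax , ¬Bx) → A-resp i≈j Ax , ¬Bx) A≲B)

    ≡μ⇒≲ : ∀ {A B} → _≡μ_ μ A B → A ≲ B
    ≡μ⇒≲ = negligible-⊆ inj₁

    ≡μ⇒≳ : ∀ {A B} → _≡μ_ μ A B → B ≲ A
    ≡μ⇒≳ = negligible-⊆ inj₂

    ≲-antisym : ∀ {A B} → A ≲ B → B ≲ A → _≡μ_ μ A B
    ≲-antisym = negligible-∪

    -- Unions of grid pieces and their index sets

    module Grid (J : Setoid ℓ ℓ) (⋃J : NegligibleUnions J) (P : Setoid.Carrier J → Pred Carrier ℓ)
                (P-resp : ∀ {j k} → Setoid._≈_ J j k → P j ⊆ P k)
                (P≄0 : ∀ j → ¬ Negligible μ (P j)) (grid : _≡μ⨆[_]_ μ U J P) where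
      open Setoid J using () renaming (Carrier to Index; _≈_ to _≈ⱼ_)
      open _≡μ⨆[_]_ grid

      ⟦_⟧ : Pred Index ℓ → Pred Carrier ℓ
      ⟦ Φ ⟧ x = ∃[ j ] (Φ j × P j x)

      negligible-∩⟦⟧ : ∀ {Φ j} → Φ Respects _≈ⱼ_ → ¬ Φ j → Negligible μ (P j ∩ ⟦ Φ ⟧)
      negligible-∩⟦⟧ {Φ} {j} Φ-resp j∉Φ = negligible-⊆
        (λ (Pjx , k , Φk , Pkx) → k , Φk , Pjx , Pkx)
        (⋃J (λ i≈k (Φi , Pjx , Pix) → Φ-resp i≈k Φi , Pjx , P-resp i≈k Pix)
          λ k → negligible-when (Φ k) λ Φk → disjoint λ j≈k → j∉Φ (Φ-resp (Setoid.sym J j≈k) Φk))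

      negligible-⟦⟧∩⟦⟧ : ∀ {Φ Ξ} → Φ Respects _≈ⱼ_ → Ξ Respects _≈ⱼ_ → Φ ⊥ Ξ →
                         Negligible μ (⟦ Φ ⟧ ∩ ⟦ Ξ ⟧)
      negligible-⟦⟧∩⟦⟧ {Φ} Φ-resp Ξ-resp Φ⊥Ξ = negligible-⊆
        (λ ((j , Φj , Pjx) , Ξx) → j , Φj , Pjx , Ξx)
        (⋃J (λ j≈k (Φj , Pjx , Ξx) → Φ-resp j≈k Φj , P-resp j≈k Pjx , Ξx)
          λ j → negligible-when (Φ j) λ Φj → negligible-∩⟦⟧ Ξ-resp λ Ξj → Φ⊥Ξ (Φj , Ξj))

      -- Otherwise `P j` would be almost contained in a union from which it is almost disjoint,
      -- hence negligible.
      ≲⟦⟧⇒∈ : ∀ {Φ j} → Φ Respects _≈ⱼ_ → P j ≲ ⟦ Φ ⟧ → Φ j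
      ≲⟦⟧⇒∈ Φ-resp P≲Φ = decidable-stable em↓ λ j∉Φ → P≄0 _
        (negligible-≲ (negligible-⊆ (λ (Pjx , ¬PΦx) → Pjx , λ Φx → ¬PΦx (Pjx , Φx)) P≲Φ)
          (negligible-∩⟦⟧ Φ-resp j∉Φ))

      -- Abstract form of the renaming: each `T i` is traded for an index set `Φ i` whose pieces
      -- fill it up to negligible sets.
      module Substitution (I : Setoid ℓ ℓ) (⋃I : NegligibleUnions I)
               (T : Setoid.Carrier I → Pred Carrier ℓ) (Φ : Setoid.Carrier I → Pred Index ℓ)
               (T-resp : ∀ {i j} → Setoid._≈_ I i j → T i ⊆ T j)
               (Φ-cong : ∀ {i j} → Setoid._≈_ I i j → Φ i ⊆ Φ j)
               (Φ-resp : ∀ i → Φ i Respects _≈ⱼ_)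
               (T≲Φ : ∀ i → T i ≲ ⟦ Φ i ⟧) (Φ≲T : ∀ i → ⟦ Φ i ⟧ ≲ T i) where

        tiling⇒exact : _≡μ⨆[_]_ μ U I T → U {ℓ = ℓ} ≐⨆[ I ] Φ
        tiling⇒exact tiling = record
          -- A common index `k` would put the piece `P k` almost inside the negligible intersection
          -- of `T i` and `T j`.
          { disjoint = λ {i} {j} i≉j {k} (Φik , Φjk) → P≄0 k
              (negligible-≲ (⊆⇒≲ λ Pkx → (k , Φik , Pkx) , (k , Φjk , Pkx))
                (negligible-≲ (≲-∩ (Φ≲T i) (Φ≲T j)) (tiling.disjoint i≉j)))
          -- Every piece lies in the whole space, which the `T i` almost cover, and each `T i` is
          -- almost filled by pieces indexed in `Φ i`.
          ; union = (λ _ → ≲⟦⟧⇒∈ {Φ = ⋃ (Setoid.Carrier I) Φ} (λ j≈k (i , Φij) → i , Φ-resp i j≈k Φij)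
              (≲-trans (⊆⇒≲ _) (≲-trans (≡μ⇒≲ tiling.union)
                (⋃-≲ I ⋃I T-resp λ i →
                  ≲-trans (T≲Φ i) (⊆⇒≲ λ (j , Φij , Pjx) → j , (i , Φij) , Pjx))))) , _
          }
          where module tiling = _≡μ⨆[_]_ tiling

        exact⇒tiling : U {ℓ = ℓ} ≐⨆[ I ] Φ → _≡μ⨆[_]_ μ U I T
        exact⇒tiling exact = record
          { disjoint = λ {i} {j} i≉j → negligible-≲ (≲-∩ (T≲Φ i) (T≲Φ j))
              (negligible-⟦⟧∩⟦⟧ (Φ-resp i) (Φ-resp j) (exact.disjoint i≉j))
          ; union = ≲-antisym
              (≲-trans (≡μ⇒≲ union) (≲-trans
                (⊆⇒≲ λ (j , Pjx) → let (i , Φij) = proj₁ exact.union _ in i , j , Φij , Pjx)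
                (⋃-≲ I ⋃I (λ { i≈i′ (j , Φij , Pjx) → j , Φ-cong i≈i′ Φij , Pjx })
                  λ i → ≲-trans (Φ≲T i) (⊆⇒≲ λ Tx → i , Tx))))
              (⊆⇒≲ _)
          }
          where module exact = _≐⨆[_]_ exact

    -- Cutting a set along finitely many Borel sets

    Decides : Pred Carrier ℓ → Pred Carrier ℓ → Set ℓ
    Decides K A = K ⊆ A ⊎ K ⊥ A

    -- Describes the atoms of `F` cut by the listed sets. Negligible atoms cannot be tiles, so they
    -- are collected in `rest`.
    record Refinement {j} {J : Set j} (F : Pred Carrier ℓ) (A : J → Pred Carrier ℓ)
                      (js : List J) : Set (lsuc ℓ Level.⊔ j) where
      field
        pieces   : List (Pred Carrier ℓ)
        isTiles  : All (IsTile μ) pieces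
        inside   : All (_⊆ F) pieces
        disjoint : AllPairs _⊥_ pieces
        rest     : Pred Carrier ℓ
        null     : Negligible μ rest
        cover    : ∀ {x} → F x → rest x ⊎ Any (λ K → K x) pieces
        decided  : All (λ K → All (λ j → Decides K (A j)) js) pieces

    -- Each listed set splits `F` into an inner and an outer half, refined separately by the
    -- remaining sets. Only once the list is exhausted is an atom tested for negligibility.
    refine : ∀ {j} {J : Set j} {F} {A : J → Pred Carrier ℓ} (js : List J) →
             Borel 𝒲 F → (∀ j → Borel 𝒲 (A j)) → Refinement F A js
    refine {F = F} [] bF bA with em {Negligible μ F}
    ... | yes null = record
      { pieces = [] ; isTiles = [] ; inside = [] ; disjoint = []
      ; rest = F ; null = null ; cover = inj₁ ; decided = [] }
    ... | no ¬null = record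
      { pieces = F ∷ [] ; isTiles = (bF , ¬negligible⇒positive ¬null) ∷ [] ; inside = id ∷ []
      ; disjoint = [] ∷ [] ; rest = ∅ ; null = negligible-∅
      ; cover = λ Fx → inj₂ (here Fx) ; decided = [] ∷ [] }
    refine {F = F} {A} (j ∷ js) bF bA = record
      { pieces   = In.pieces ++ Out.pieces
      ; isTiles  = All.++⁺ In.isTiles Out.isTiles
      ; inside   = All.++⁺ (All.map (λ K⊆ {x} Kx → proj₁ (K⊆ Kx)) In.inside)
                           (All.map (λ K⊆ {x} Kx → proj₁ (K⊆ Kx)) Out.inside)
      ; disjoint = AllPairs.++⁺ In.disjoint Out.disjoint
          (All.map (λ K⊆ → All.map (λ L⊆ {x} (Kx , Lx) → proj₂ (L⊆ Lx) (proj₂ (K⊆ Kx))) Out.inside)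
                   In.inside)
      ; rest     = In.rest ∪ Out.rest
      ; null     = negligible-∪ In.null Out.null
      ; cover    = cover
      ; decided  = All.++⁺
          (All.zipWith (λ { (K⊆ , Ks) → inj₁ (λ Kx → proj₂ (K⊆ Kx)) ∷ Ks }) (In.inside , In.decided))
          (All.zipWith (λ { (K⊆ , Ks) → inj₂ (λ (Kx , Ax) → proj₂ (K⊆ Kx) Ax) ∷ Ks })
                       (Out.inside , Out.decided))
      }
      where
      module In  = Refinement (refine js (Borel-∩ bF (bA j)) bA)
      module Out = Refinement (refine js (Borel-∖ bF (bA j)) bA)

      cover : ∀ {x} → F x → (In.rest ∪ Out.rest) x ⊎ Any (λ K → K x) (In.pieces ++ Out.pieces)
      cover {x} Fx with em↓ {A j x}
      ... | yes Ax = [ (λ r → inj₁ (inj₁ r)) , (λ K → inj₂ (Any.++⁺ˡ K)) ]′ (In.cover (Fx , Ax))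
      ... | no ¬Ax = [ (λ r → inj₁ (inj₂ r)) , (λ K → inj₂ (Any.++⁺ʳ In.pieces K)) ]′ (Out.cover (Fx , ¬Ax))

    module _ {j} {J : Set j} {F} {A : J → Pred Carrier ℓ} {js} (R : Refinement F A js) where
      open Refinement R

      pieces-disjoint : ∀ i k → ¬ i ≡ k → lookup pieces i ⊥ lookup pieces k
      pieces-disjoint i k i≢k =
        lookup-AllPairs {R = _⊥_} (λ P⊥Q (Qx , Px) → P⊥Q (Px , Qx)) disjoint i k i≢k

      piece-isTile : ∀ i → IsTile μ (lookup pieces i)
      piece-isTile i = All.lookup isTiles (∈-lookup i)

      refinementTiles : FiniteTileSet μ
      refinementTiles = record
        { size     = length pieces
        ; tile     = lookup pieces
        ; isTile   = piece-isTile
        -- Two disjoint pieces that coincide would be empty, yet tiles are not negligible.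
        ; distinct = λ {i} {k} (Kᵢ⊆Kₖ , _) → decidable-stable (i Fin.≟ k) λ i≢k →
            positive⇒¬negligible (proj₂ (piece-isTile i))
              (negligible-⊆ (λ Kᵢx → contradiction (Kᵢx , Kᵢ⊆Kₖ Kᵢx) (pieces-disjoint i k i≢k))
                negligible-∅)
        }

      piece⊆ : ∀ i → lookup pieces i ⊆ F
      piece⊆ i = All.lookup inside (∈-lookup i)

      ≲⋃pieces : F ≲ ⋃ (Fin (length pieces)) (lookup pieces)
      ≲⋃pieces = negligible-⊆
        (λ (Fx , ¬∃) → [ id , (λ Kx → contradiction (index Kx , Any.lookup-index Kx) ¬∃) ]′ (cover Fx))
        null

      piece-decides : ∀ i → All (λ j → Decides (lookup pieces i) (A j)) js
      piece-decides i = All.lookup decided (∈-lookup i)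

  -- Translates of Borel and negligible sets

  module Translates {𝒲 : TopologicalSpace ℓ} (μ : BorelMeasure 𝒲) {G : Group ℓ ℓ}
                    (act : Action G 𝒲) (preserving : NegligibilityPreserving μ act) where
    private module G = Group G
    open TopologicalSpace 𝒲 using (Carrier; _≈_; sym; trans) renaming (refl to ≈-refl)
    open Action act
    open Null μ

    cancelˡ : ∀ g x → g G.⁻¹ • g • x ≈ x
    cancelˡ g x = trans (sym (compatible (g G.⁻¹) g x))
      (trans (•-cong (G.inverseˡ g) ≈-refl) (identity x))

    cancelʳ : ∀ g x → g • g G.⁻¹ • x ≈ x
    cancelʳ g x = trans (sym (compatible g (g G.⁻¹) x))
      (trans (•-cong (G.inverseʳ g) ≈-refl) (identity x))

    •-injective : ∀ g {x y} → g • x ≈ g • y → x ≈ y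
    •-injective g gx≈gy = trans (sym (cancelˡ g _)) (trans (•-cong G.refl gx≈gy) (cancelˡ g _))

    Borel-preimage : ∀ g {A} → Borel 𝒲 A → Borel 𝒲 (λ x → A (g • x))
    Borel-preimage g (isOpen oA)        = isOpen (continuous g oA)
    Borel-preimage g (complement bA)    = complement (Borel-preimage g bA)
    Borel-preimage g (countable-⋃ A bA) =
      countable-⋃ (λ n x → A n (g • x)) (λ n → Borel-preimage g (bA n))
    Borel-preimage g (resp-≐ A≐B bA)    = resp-≐ (proj₁ A≐B , proj₂ A≐B) (Borel-preimage g bA)

    -- The image under `g` is the preimage under the inverse of `g`, to which continuity applies.
    Borel-· : ∀ g {A} → Borel 𝒲 A → Borel 𝒲 (g · A)
    Borel-· g bA = resp-≐
      ( (λ Ag⁻¹x → _ , Ag⁻¹x , cancelʳ g _)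
      , λ (x , Ax , gx≈y) →
          Borel-respects bA (trans (sym (cancelˡ g x)) (•-cong G.refl gx≈y)) Ax )
      (Borel-preimage (g G.⁻¹) bA)

    ·-mono : ∀ g {A B : Pred Carrier ℓ} → A ⊆ B → g · A ⊆ g · B
    ·-mono g A⊆B (x , Ax , gx≈y) = x , A⊆B Ax , gx≈y

    ·-cong : ∀ {g h} (A : Pred Carrier ℓ) → g G.≈ h → g · A ⊆ h · A
    ·-cong A g≈h (x , Ax , gx≈y) = x , Ax , trans (•-cong (G.sym g≈h) ≈-refl) gx≈y

    ⊆⁻¹·· : ∀ g (A : Pred Carrier ℓ) → A ⊆ (g G.⁻¹) · (g · A)
    ⊆⁻¹·· g A {x} Ax = g • x , (x , Ax , ≈-refl) , cancelˡ g x

    ⁻¹··⊆ : ∀ g {A} → Borel 𝒲 A → (g G.⁻¹) · (g · A) ⊆ A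
    ⁻¹··⊆ g bA (y , (x , Ax , gx≈y) , g⁻¹y≈z) =
      Borel-respects bA (trans (sym (cancelˡ g x)) (trans (•-cong G.refl gx≈y) g⁻¹y≈z)) Ax

    ·-∩ : ∀ g (A : Pred Carrier ℓ) {B} → Borel 𝒲 B → (g · A) ∩ (g · B) ⊆ g · (A ∩ B)
    ·-∩ g A bB ((x , Ax , gx≈z) , (y , By , gy≈z)) =
      x , (Ax , Borel-respects bB (•-injective g (trans gy≈z (sym gx≈z))) By) , gx≈z

    -- The hypothesis speaks of positive sets, so it is used for the inverse of `g`: were the
    -- translate of the Borel null set `B` positive, translating it back would give a positive
    -- subset of `B`.
    negligible-· : ∀ g {A} → Negligible μ A → Negligible μ (g · A)
    negligible-· g {A} null@(B , bB , A⊆B , B≃0) =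
      negligible-⊆ (·-mono g A⊆B) (decidable-stable em λ ¬null →
        positive⇒¬negligible
          (preserving (g G.⁻¹) (Borel-· g bB) (¬negligible⇒positive ¬null))
          (B , bB , ⁻¹··⊆ g bB , B≃0))

    negligible-·⁻ : ∀ g {A} → Negligible μ (g · A) → Negligible μ A
    negligible-·⁻ g {A} null = negligible-⊆ (⊆⁻¹·· g A) (negligible-· (g G.⁻¹) null)

    ·-≲ : ∀ g {A B} → A ≲ B → g · A ≲ g · B
    ·-≲ g A≲B = negligible-⊆
      (λ ((x , Ax , gx≈y) , ¬gBy) → x , (Ax , λ Bx → ¬gBy (x , Bx , gx≈y)) , gx≈y)
      (negligible-· g A≲B)

-- Finite unions of compact sets

module _ {ℓ : Level} (𝒲 : TopologicalSpace ℓ) where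
  open TopologicalSpace 𝒲 using (Carrier)

  Compact-∪ : ∀ {K L : Pred Carrier ℓ} → Compact 𝒲 K → Compact 𝒲 L → Compact 𝒲 (K ∪ L)
  Compact-∪ cK cL V oV K∪L⊆V =
    let (is , K⊆) = cK V oV (K∪L⊆V ∘ inj₁)
        (js , L⊆) = cL V oV (K∪L⊆V ∘ inj₂)
    in is ++ js , [ (λ Kx → Any.++⁺ˡ (K⊆ Kx)) , (λ Lx → Any.++⁺ʳ is (L⊆ Lx)) ]′

  -- Proper discontinuity compares a compact set with its own translates; a single compact set
  -- around the fundamental domain and all tiles puts their encounters in that form.
  common-compact : ∀ {A : Pred Carrier ℓ} n (T : Fin n → Pred Carrier ℓ) →
                   RelativelyCompact 𝒲 A → (∀ i → RelativelyCompact 𝒲 (T i)) →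
                   ∃[ K ] (Compact 𝒲 K × A ⊆ K × ∀ i → T i ⊆ K)
  common-compact zero    T (K , cK , A⊆K) rcT = K , cK , A⊆K , λ ()
  common-compact (suc n) T rcA rcT =
    let (K , cK , A⊆K , T⊆K) = common-compact n (T ∘ suc) rcA (rcT ∘ suc)
        (L , cL , T₀⊆L)      = rcT zero
    in L ∪ K , Compact-∪ cL cK , inj₂ ∘ A⊆K ,
       λ { zero → inj₁ ∘ T₀⊆L ; (suc i) → inj₂ ∘ T⊆K i }

-- The tiles cut from the fundamental domain, and their grid

module Construction
  {ℓ : Level} (em : ExcludedMiddle (lsuc ℓ))
  {𝒲 : TopologicalSpace ℓ} (μ : BorelMeasure 𝒲) {G : Group ℓ ℓ} (countG : Countable (Group.setoid G))
  (act : Action G 𝒲) (preserving : NegligibilityPreserving μ act)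
  (properly : ProperlyDiscontinuous μ act)
  {F : Pred (TopologicalSpace.Carrier 𝒲) ℓ} (domain : IsFundamentalDomain μ act F)
  (𝒯 : FiniteTileSet μ) {K : Pred (TopologicalSpace.Carrier 𝒲) ℓ} (cK : Compact 𝒲 K)
  (F⊆K : F ⊆ K) (𝒯⊆K : ∀ i → tile 𝒯 i ⊆ K)
  where

  private module G = Group G
  open TopologicalSpace 𝒲 using (Carrier; sym; trans) renaming (refl to ≈-refl)
  open Action act
  open Classical em
  open Null μ
  open Translates μ act preserving
  module F = _≡μ⨆[_]_ (proj₂ domain)

  ⋃G : NegligibleUnions G.setoid
  ⋃G = countable⇒negligibleUnions G.setoid countG

  bF : Borel 𝒲 F
  bF = proj₁ domain

  b𝒯 : ∀ i → Borel 𝒲 (tile 𝒯 i)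
  b𝒯 i = proj₁ (isTile 𝒯 i)

  open SetoidMembership G.setoid using (_∈_)

  near : List G.Carrier
  near = proj₁ (properly {K} cK)

  meets⇒near : ∀ {g A} i → A ⊆ F → ¬ Negligible μ ((g · A) ∩ tile 𝒯 i) → g ∈ near
  meets⇒near {g} i A⊆F ¬null = proj₂ (properly {K} cK) (¬negligible⇒positive λ null →
    ¬null (negligible-⊆ (λ (gAx , Tx) → ·-mono g (F⊆K ∘ A⊆F) gAx , 𝒯⊆K i Tx) null))

  -- The cutting sets are preimages of tiles under `g`, that is, translates by the inverse of `g`: a
  -- piece is decided against such a preimage exactly when its translate by `g` is decided against
  -- the tile.
  refinement : Refinement F (λ (g , i) x → tile 𝒯 i (g • x)) (cartesianProduct near (allFin (size 𝒯)))
  refinement = refine _ bF (λ (g , i) → Borel-preimage g (b𝒯 i))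

  𝒦 : FiniteTileSet μ
  𝒦 = refinementTiles refinement

  b𝒦 : ∀ k → Borel 𝒲 (tile 𝒦 k)
  b𝒦 k = proj₁ (isTile 𝒦 k)

  rc𝒦 : ∀ k → RelativelyCompact 𝒲 (tile 𝒦 k)
  rc𝒦 k = K , cK , F⊆K ∘ piece⊆ refinement k

  J : Setoid ℓ ℓ
  J = Placements μ act 𝒦

  open Setoid J using () renaming (Carrier to Index; _≈_ to _≈ⱼ_)

  P : Index → Pred Carrier ℓ
  P = placed μ act 𝒦

  ⋃J : NegligibleUnions J
  ⋃J = negligibleUnions-×Fin G.setoid (size 𝒦) ⋃G

  P-resp : ∀ {j k} → j ≈ⱼ k → P j ⊆ P k
  P-resp {g , i} (g≈h , refl) = ·-cong (tile 𝒦 i) g≈h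

  P≄0 : ∀ j → ¬ Negligible μ (P j)
  P≄0 (g , k) null = positive⇒¬negligible (proj₂ (isTile 𝒦 k)) (negligible-·⁻ g null)

  -- For different group elements the pieces lie in almost disjoint translates of `F`. For equal
  -- ones, injectivity of the action reduces the claim to the disjointness of the pieces inside `F`.
  P-disjoint : ∀ {j k} → ¬ j ≈ⱼ k → Negligible μ (P j ∩ P k)
  P-disjoint {g , i} {h , k} j≉k with em↓ {g G.≈ h}
  ... | no g≉h = negligible-⊆
    (λ (x∈ , x∈′) → ·-mono g (piece⊆ refinement i) x∈ , ·-mono h (piece⊆ refinement k) x∈′)
    (F.disjoint g≉h)
  ... | yes g≈h = negligible-⊆
    (λ (x∈ , x∈′) →
      let (_ , meet , _) = ·-∩ g (tile 𝒦 i) (b𝒦 k) (x∈ , ·-cong (tile 𝒦 k) (G.sym g≈h) x∈′)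
      in contradiction meet (pieces-disjoint refinement i k λ i≡k → j≉k (g≈h , i≡k)))
    negligible-∅

  grid : YieldsGrid μ act 𝒦
  grid = record
    { disjoint = P-disjoint
    ; union    = ≲-antisym
        (≲-trans (≡μ⇒≲ F.union) (⋃-≲ G.setoid ⋃G (·-cong F) λ g →
          ≲-trans (·-≲ g (≲⋃pieces refinement))
                  (⊆⇒≲ λ (x , (k , Kx) , gx≈y) → (g , k) , x , Kx , gx≈y)))
        (⊆⇒≲ _)
    }

  open Grid J ⋃J P P-resp P≄0 grid

  -- Tiles as unions of grid pieces

  -- If the intersection is not negligible, then `g` occurs in `near`, so the refinement has decided
  -- the piece against the preimage of the tile; applying `g` transports the decision.
  ⊆-or-negligible : ∀ i j → P j ⊆ tile 𝒯 i ⊎ Negligible μ (P j ∩ tile 𝒯 i)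
  ⊆-or-negligible i (g , k) with em {Negligible μ (P (g , k) ∩ tile 𝒯 i)}
  ... | yes null = inj₂ null
  ... | no ¬null = translated decides
    where
    A : G.Carrier × Fin (size 𝒯) → Pred Carrier ℓ
    A (g , i) x = tile 𝒯 i (g • x)

    A-cong : ∀ {g h} i → g G.≈ h → A (g , i) ⊆ A (h , i)
    A-cong i g≈h = Borel-respects (b𝒯 i) (•-cong g≈h ≈-refl)

    -- Occurrence in `near` is only up to equality in the group, so a decision found in the list
    -- must be transported along it.
    decides-resp : ∀ {j j′} → Setoid._≈_ (Placements μ act 𝒯) j j′ →
                   Decides (tile 𝒦 k) (A j) → Decides (tile 𝒦 k) (A j′)
    decides-resp (g≈h , refl) (inj₁ K⊆A) = inj₁ λ Kx → A-cong _ g≈h (K⊆A Kx)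
    decides-resp (g≈h , refl) (inj₂ K⊥A) = inj₂ λ (Kx , Ax) → K⊥A (Kx , A-cong _ (G.sym g≈h) Ax)

    decides : Decides (tile 𝒦 k) (A (g , i))
    decides = All.lookupₛ (Placements μ act 𝒯) decides-resp (piece-decides refinement k)
      (∈-cartesianProduct⁺ G.setoid (≡.setoid (Fin (size 𝒯)))
        (meets⇒near i (piece⊆ refinement k) ¬null) (∈-allFin i))

    translated : Decides (tile 𝒦 k) (A (g , i)) →
                 P (g , k) ⊆ tile 𝒯 i ⊎ Negligible μ (P (g , k) ∩ tile 𝒯 i)
    translated (inj₁ K⊆A) = inj₁ λ (x , Kx , gx≈y) → Borel-respects (b𝒯 i) gx≈y (K⊆A Kx)
    translated (inj₂ K⊥A) = inj₂ (negligible-⊆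
      (λ ((x , Kx , gx≈y) , Ty) → ⊥-elim (K⊥A (Kx , Borel-respects (b𝒯 i) (sym gx≈y) Ty)))
      negligible-∅)

  -- Inclusion stands in for meeting T in positive measure, which lives one level too high to be a
  -- membership predicate.
  Ψ₀ : Fin (size 𝒯) → Subset J ℓ
  Ψ₀ i = record
    { member   = λ j → ∀ x → P j x → tile 𝒯 i x
    ; respects = λ j≈k P⊆T x Px → P⊆T x (P-resp (Setoid.sym J j≈k) Px)
    }

  poly : ∀ i → IsPoly μ act 𝒦 (tile 𝒯 i)
  poly i = record
    { Ψ         = Ψ₀ i
    -- A piece contained in the tile meets it in the whole piece, which is not negligible, so its
    -- group element occurs in `near`.
    ; finite    = cartesianProduct near (allFin (size 𝒦)) , λ {(g , k)} P⊆T →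
        ∈-cartesianProduct⁺ G.setoid (≡.setoid (Fin (size 𝒦)))
          (meets⇒near i (piece⊆ refinement k) λ null →
            P≄0 (g , k) (negligible-⊆ (λ {x} Px → Px , P⊆T x Px) null))
          (∈-allFin k)
    ; decompose = record
        { disjoint = P-disjoint
        ; union    = ≲-antisym T≲
            (⊆⇒≲ λ ((_ , P⊆T) , Px) → P⊆T _ Px)
        }
    }
    where
    T≲ : tile 𝒯 i ≲ (λ x → ∃[ c ] P (proj₁ {B = member (Ψ₀ i)} c) x)
    -- The tile is first split along the whole grid; then a piece inside it is indexed by `Ψ₀ i`,
    -- and any other meets it negligibly.
    T≲ = ≲-trans
         (negligible-⊆ (λ (Tx , ∄) → _ , λ (j , Px) → ∄ (j , Tx , Px))
           (≡μ⇒≲ (_≡μ⨆[_]_.union grid)))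
         (⋃-≲ J ⋃J (λ j≈k (Tx , Px) → Tx , P-resp j≈k Px) covered)
      where
      covered : ∀ j → tile 𝒯 i ∩ P j ≲ (λ x → ∃[ c ] P (proj₁ {B = member (Ψ₀ i)} c) x)
      covered j with ⊆-or-negligible i j
      ... | inj₁ P⊆T  = ⊆⇒≲ λ (_ , Px) → (j , λ _ → P⊆T) , Px
      ... | inj₂ null = negligible-⊆ (λ ((Tx , Px) , _) → Px , Tx) null

  -- Cotilers and exact cotilers, for an arbitrary choice of decompositions

  module _ (Ψ : ∀ i → IsPoly μ act 𝒦 (tile 𝒯 i)) (C : Subset (Placements μ act 𝒯) ℓ)
           (countC : Countable (subsetoid (Placements μ act 𝒯) C)) where

    I : Setoid ℓ ℓ
    I = subsetoid (Placements μ act 𝒯) C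

    open Setoid I using () renaming (Carrier to Indexᵢ; _≈_ to _≈ᵢ_)

    module Ψ i = IsPoly (Ψ i)

    T : Indexᵢ → Pred Carrier ℓ
    T c = placed μ act 𝒯 (proj₁ c)

    Φ : Indexᵢ → Pred Index ℓ
    Φ ((g , i) , _) = translate μ act 𝒦 g (member (Ψ.Ψ i))

    T-resp : ∀ {i j} → i ≈ᵢ j → T i ⊆ T j
    T-resp {(g , i) , _} (g≈h , refl) = ·-cong (tile 𝒯 i) g≈h

    Φ-cong : ∀ {i j} → i ≈ᵢ j → Φ i ⊆ Φ j
    Φ-cong (g≈h , refl) (j , Ψj , gj≈k) =
      j , Ψj , Setoid.trans J (G.∙-cong (G.sym g≈h) G.refl , refl) gj≈k

    Φ-resp : ∀ i → Φ i Respects _≈ⱼ_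
    Φ-resp c k≈k′ (j , Ψj , gj≈k) = j , Ψj , Setoid.trans J gj≈k k≈k′

    -- The decomposition of the tile is translated by `g`; compatibility of the action turns `g`
    -- applied to an `h`-translate into a translate by the product, which is how `translate` acts on
    -- indices.
    T≲Φ : ∀ i → T i ≲ ⟦ Φ i ⟧
    T≲Φ ((g , i) , _) = ≲-trans (·-≲ g (≡μ⇒≲ (_≡μ⨆[_]_.union (Ψ.decompose i))))
      (⊆⇒≲ λ { (x , (((h , k) , Ψj) , z , Kz , hz≈x) , gx≈y) →
        (g G.∙ h , k) , ((h , k) , Ψj , Setoid.refl J) ,
        z , Kz , trans (compatible g h z) (trans (•-cong G.refl hz≈x) gx≈y) })

    Φ≲T : ∀ i → ⟦ Φ i ⟧ ≲ T i
    Φ≲T ((g , i) , _) = ≲-trans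
      (⊆⇒≲ λ { ((h′ , k) , ((h , _) , Ψj , gh≈h′ , refl) , z , Kz , h′z≈y) →
        h • z , (((h , k) , Ψj) , z , Kz , ≈-refl) ,
        trans (sym (compatible g h z)) (trans (•-cong gh≈h′ ≈-refl) h′z≈y) })
      (·-≲ g (≡μ⇒≳ (_≡μ⨆[_]_.union (Ψ.decompose i))))

    cotiler⇔exact : IsCotiler μ act 𝒯 C ⇔ IsExactCotiler μ act 𝒯 𝒦 Ψ C
    cotiler⇔exact = mk⇔
      (λ (_ , tiling) → tiling⇒exact tiling)
      -- Exactness concerns index sets only, so the countability required of a cotiler comes from
      -- `countC`.
      (λ exact → countC , exact⇒tiling exact)
      where open Substitution I (countable⇒negligibleUnions I countC) T Φ
              (λ {i} {j} → T-resp {i} {j}) (λ {i} {j} → Φ-cong {i} {j}) Φ-resp T≲Φ Φ≲T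

-- Assembly over a compact set containing the domain and all tiles

theorem29 : ∀ {ℓ : Level} → ExcludedMiddle (lsuc ℓ) →
    (𝒲 : TopologicalSpace ℓ) (μ : BorelMeasure 𝒲) → Nontrivial μ →
    (G : Group ℓ ℓ) → Countable (Group.setoid G) →
    (act : Action G 𝒲) →
    NegligibilityPreserving μ act →
    Cocompact act →
    ProperlyDiscontinuous μ act →
    (∃[ F ] (IsFundamentalDomain μ act F × RelativelyCompact 𝒲 F)) →
    (𝒯 : FiniteTileSet μ) → (∀ i → RelativelyCompact 𝒲 (tile 𝒯 i)) →
    ∃[ 𝒦 ] ((∀ k → RelativelyCompact 𝒲 (tile 𝒦 k)) ×
    YieldsGrid μ act 𝒦 ×
    (∀ i → IsPoly μ act 𝒦 (tile 𝒯 i)) ×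
    ((Ψ : ∀ i → IsPoly μ act 𝒦 (tile 𝒯 i)) →
    (C : Subset (Placements μ act 𝒯) ℓ) →
    Countable (subsetoid (Placements μ act 𝒯) C) →
    IsCotiler μ act 𝒯 C ⇔ IsExactCotiler μ act 𝒯 𝒦 Ψ C))
theorem29 em 𝒲 μ _ G countG act preserving _ properly (F , domain , rcF) 𝒯 rc𝒯 =
  let (_ , cK , F⊆K , 𝒯⊆K) = common-compact 𝒲 (size 𝒯) (tile 𝒯) rcF rc𝒯
      open Construction em μ countG act preserving properly domain 𝒯 cK F⊆K 𝒯⊆K
  in 𝒦 , rc𝒦 , grid , poly , cotiler⇔exact
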